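{- Let $\mathbb K=(G,M,I)$ be a context. Let $\mathfrak D\subseteq \mathrm{Fm}_1\times\mathrm{Fm}_2$ be a set of formula pairs together with maps $r:\mathfrak D\to \mathtt{SC}^{left}/\!\equiv^{left}$, $e:\mathtt{SC}^{left}/\!\equiv^{left}\to\mathfrak D$, $r':\mathfrak D\to\mathtt{SC}^{right}/\!\equiv^{right}$, $e':\mathtt{SC}^{right}/\!\equiv^{right}\to\mathfrak D$ such that $r\circ e=\mathrm{id}$ and $r'\circ e'=\mathrm{id}$ on $\mathtt{SC}^{left}/\!\equiv^{left}$ and $\mathtt{SC}^{right}/\!\equiv^{right}$ respectively. For $x,y\in\mathfrak D$ define $x\sqcap y:=e(r(x)\wedge r(y))$, $x\sqcup y:=e'(r'(x)\vee r'(y))$, $\bar\neg x:=e(\neg r(x))$, $\lrcorner x:=e'(\neg r'(x))$, $\bot_{\mathfrak D}:=e([(\bot_{s_1},\boxminus_{\mathfrak o}\bot_{s_1})])$ and $\top_{\mathfrak D}:=e'([(\boxminus_{\mathfrak p}\bot_{s_2},\bot_{s_2})])$. Then $(\mathfrak D,\sqcap,\sqcup,\bar\neg,\lrcorner,\top_{\mathfrak D},\bot_{\mathfrak D})$ is a pure double Boolean algebra if and only if the following conditions hold: (a) $e\circ r\circ e'\circ r'=e'\circ r'\circ e\circ r$; (b) $e(r(x)\wedge r(e'(r'(x)\vee r'(y))))=e(r(x))$ and $e'(r'(x)\vee r'(e(r(x)\wedge r(y))))=e'(r'(x))$ for all $x,y\in\mathfrak D$; (c) $r(e'([(\boxminus_{\mathfrak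 p}\bot_{s_2},\bot_{s_2})]))=\neg[(\bot_{s_1},\boxminus_{\mathfrak o}\bot_{s_1})]$ and $r'(e([(\bot_{s_1},\boxminus_{\mathfrak o}\bot_{s_1})]))=\neg[(\boxminus_{\mathfrak p}\bot_{s_2},\bot_{s_2})]$; (d) for each $x\in\mathfrak D$, either $e(r(x))=x$ or $e'(r'(x))=x$.
   Context: Language. There are two sorts $s_1,s_2$, with disjoint nonempty sets of propositional variables $P_{s_1},P_{s_2}$. $\mathrm{Fm}_1$ (sort $s_1$) and $\mathrm{Fm}_2$ (sort $s_2$) are defined by simultaneous induction: $\varphi ::= p\mid \neg\varphi\mid\varphi\wedge\varphi\mid \Box_{\mathfrak p}\psi\mid \boxminus_{\mathfrak p}\psi$ ($p\in P_{s_1}$, $\psi\in\mathrm{Fm}_2$) and $\psi::= q\mid\neg\psi\mid\psi\wedge\psi\mid\Box_{\mathfrak o}\varphi\mid\boxminus_{\mathfrak o}\varphi$ ($q\in P_{s_2}$, $\varphi\in\mathrm{Fm}_1$). Other Boolean connectives are the usual abbreviations; $\bot_{s_i}$ is falsum of sort $s_i$. Semantics. A context is $\mathbb K=(G,M,I)$ with $G,M$ sets and $I\subseteq G\times M$. A $\mathbb K$-based model is $\mathfrak M=(G,M,I,v)$, where $v$ assigns to each $p\in P_{s_1}$ a subset of $G$ and to each $q\in P_{s_2}$ a subset of $M$. Sort-$s_1$ formulas are evaluated at $g\in G$, sort-$s_2$ formulas at $m\in M$: variables by $v$, Boolean connectives classically, and: $g\models\Box_{\mathfrak p}\psi$ iff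 for all $m$, $Igm$ implies $m\models\psi$; $m\models\Box_{\mathfrak o}\varphi$ iff for all $g$, $Igm$ implies $g\models\varphi$; $g\models\boxminus_{\mathfrak p}\psi$ iff for all $m$, $m\models\psi$ implies $Igm$; $m\models\boxminus_{\mathfrak o}\varphi$ iff for all $g$, $g\models\varphi$ implies $Igm$. Write $\models^{\mathfrak C_{\mathbb K}}_{s_i}\chi$ if the sort-$s_i$ formula $\chi$ holds at all points of sort $s_i$ in all $\mathbb K$-based models. Semiconcepts. A pair $(\varphi,\psi)\in\mathrm{Fm}_1\times\mathrm{Fm}_2$ is a left semiconcept if $\models^{\mathfrak C_{\mathbb K}}_{s_2}\boxminus_{\mathfrak o}\varphi\leftrightarrow\psi$, and a right semiconcept if $\models^{\mathfrak C_{\mathbb K}}_{s_1}\varphi\leftrightarrow\boxminus_{\mathfrak p}\psi$; the sets of these are $\mathtt{SC}^{left}$ and $\mathtt{SC}^{right}$. On $\mathtt{SC}^{left}$, $(\varphi_1,\psi_1)\equiv^{left}(\varphi_2,\psi_2)$ iff $\models^{\mathfrak C_{\mathbb K}}_{s_1}\varphi_1\leftrightarrow\varphi_2$; on $\mathtt{SC}^{right}$, $(\varphi_1,\psi_1)\equiv^{right}(\varphi_2,\psi_2)$ iff $\models^{\mathfrak C_{\mathbb K}}_{s_2}\psi_1\leftrightarrow\psi_2$. $[\cdot]$ denotes equivalence classes. On $\mathtt{SC}^{left}/\!\equiv^{left}$: $[(\varphi,\psi)]\wedge[(\varphi',\psi')]:=[(\varphi\wedge\varphi',\boxminus_{\mathfrak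 o}(\varphi\wedge\varphi'))]$, $\neg[(\varphi,\psi)]:=[(\neg\varphi,\boxminus_{\mathfrak o}\neg\varphi)]$. On $\mathtt{SC}^{right}/\!\equiv^{right}$: $[(\varphi,\psi)]\vee[(\varphi',\psi')]:=[(\boxminus_{\mathfrak p}(\psi\wedge\psi'),\psi\wedge\psi')]$, $\neg[(\varphi,\psi)]:=[(\boxminus_{\mathfrak p}\neg\psi,\neg\psi)]$. A double Boolean algebra (dBa) is an algebra $(D,\sqcup,\sqcap,\bar\neg,\lrcorner,\top,\bot)$ satisfying, for all $x,y,z$, with $x\bar\vee y:=\bar\neg(\bar\neg x\sqcap\bar\neg y)$ and $x\bar\wedge y:=\lrcorner(\lrcorner x\sqcup\lrcorner y)$: (1a) $(x\sqcap x)\sqcap y=x\sqcap y$; (1b) $(x\sqcup x)\sqcup y=x\sqcup y$; (2a) $x\sqcap y=y\sqcap x$; (2b) $x\sqcup y=y\sqcup x$; (3a) $\bar\neg(x\sqcap x)=\bar\neg x$; (3b) $\lrcorner(x\sqcup x)=\lrcorner x$; (4a) $x\sqcap(x\sqcup y)=x\sqcap x$; (4b) $x\sqcup(x\sqcap y)=x\sqcup x$; (5a) $x\sqcap(y\bar\vee z)=(x\sqcap y)\bar\vee(x\sqcap z)$; (5b) $x\sqcup(y\bar\wedge z)=(x\sqcup y)\bar\wedge(x\sqcup z)$; (6a) $x\sqcap(x\bar\vee y)=x\sqcap x$; (6b) $x\sqcup(x\bar\wedge y)=x\sqcup x$; (7a) $\bar\neg\bar\neg(x\sqcap y)=x\sqcap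 y$; (7b) $\lrcorner\lrcorner(x\sqcup y)=x\sqcup y$; (8a) $x\sqcap\bar\neg x=\bot$; (8b) $x\sqcup\lrcorner x=\top$; (9a) $\bar\neg\top=\bot$; (9b) $\lrcorner\bot=\top$; (10a) $x\sqcap(y\sqcap z)=(x\sqcap y)\sqcap z$; (10b) $x\sqcup(y\sqcup z)=(x\sqcup y)\sqcup z$; (11a) $\bar\neg\bot=\top\sqcap\top$; (11b) $\lrcorner\top=\bot\sqcup\bot$; (12) $(x\sqcap x)\sqcup(x\sqcap x)=(x\sqcup x)\sqcap(x\sqcup x)$. It is pure if for every $x$, $x\sqcap x=x$ or $x\sqcup x=x$. -}

module Defs where

open import Algebra.Core using (Op₁; Op₂)
open import Algebra.Definitions using (Congruent₁; Congruent₂; Commutative)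
open import Data.Product using (Σ; Σ-syntax; _×_; _,_; proj₁; proj₂)
open import Data.Sum using (_⊎_)
open import Function.Bundles using (Func)
open import Level as L using (Level)
open import Relation.Binary.Bundles using (Setoid)
open import Relation.Binary.Core using (Rel; REL)
import Relation.Binary.Construct.On as On
open import Relation.Binary.PropositionalEquality using (setoid)
open import Relation.Binary.Structures using (IsEquivalence)
open import Relation.Nullary using (¬_)
open import Relation.Unary using (Pred)

data Sort : Set where
  s₁ s₂ : Sort

-- Nonemptiness of each set of variables is recorded by a chosen element;
-- disjointness is automatic, since variables are indexed by their sort.
record Language (p : Level) : Set (L.suc p) where
  field
    Var  : Sort → Set p
    var₀ : ∀ s → Var s

record Context (ℓ : Level) : Set (L.suc ℓ) where
  field
    G M : Set ℓ
    I   : REL G M ℓ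

module Formulas {p} (𝓛 : Language p) where
  open Language 𝓛

  infix  9 ∼_ □𝔭_ □𝔬_ ⊟𝔭_ ⊟𝔬_
  infixr 7 _∧_
  infix  5 _⟶_ _⟷_

  data Fm : Sort → Set p where
    var : ∀ {s} → Var s → Fm s
    ∼_  : ∀ {s} → Fm s → Fm s
    _∧_ : ∀ {s} → Fm s → Fm s → Fm s
    □𝔭_ : Fm s₂ → Fm s₁
    ⊟𝔭_ : Fm s₂ → Fm s₁
    □𝔬_ : Fm s₁ → Fm s₂
    ⊟𝔬_ : Fm s₁ → Fm s₂

  _⟶_ : ∀ {s} → Fm s → Fm s → Fm s
  φ ⟶ χ = ∼ (φ ∧ ∼ χ)

  _⟷_ : ∀ {s} → Fm s → Fm s → Fm s
  φ ⟷ χ = (φ ⟶ χ) ∧ (χ ⟶ φ)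

  falsum : ∀ s → Fm s
  falsum s = var (var₀ s) ∧ ∼ var (var₀ s)

-- A subset as a setoid: its elements are equal when they are equal in the
-- ambient type, whatever the membership proofs.
Subset : ∀ {a d} {A : Set a} → Pred A d → Setoid (a L.⊔ d) a
Subset {A = A} P = On.setoid {B = Σ A P} (setoid A) proj₁

module Semantics {p ℓ} (𝓛 : Language p) (𝕂 : Context ℓ) where
  open Language 𝓛
  open Context 𝕂
  open Formulas 𝓛

  Point : Sort → Set ℓ
  Point s₁ = G
  Point s₂ = M

  Valuation : Set (p L.⊔ L.suc ℓ)
  Valuation = ∀ s → Var s → Pred (Point s) ℓ

  infix 4 _,_⊨_
  _,_⊨_ : Valuation → ∀ {s} → Point s → Fm s → Set ℓ
  v , w ⊨ var {s} x = v s x w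
  v , w ⊨ ∼ φ       = ¬ (v , w ⊨ φ)
  v , w ⊨ φ ∧ χ     = (v , w ⊨ φ) × (v , w ⊨ χ)
  v , g ⊨ □𝔭 ψ      = ∀ (m : M) → I g m → v , m ⊨ ψ
  v , g ⊨ ⊟𝔭 ψ      = ∀ (m : M) → v , m ⊨ ψ → I g m
  v , m ⊨ □𝔬 φ      = ∀ (g : G) → I g m → v , g ⊨ φ
  v , m ⊨ ⊟𝔬 φ      = ∀ (g : G) → v , g ⊨ φ → I g m

  Valid : ∀ {s} → Fm s → Set (p L.⊔ L.suc ℓ)
  Valid {s} χ = ∀ (v : Valuation) (w : Point s) → v , w ⊨ χ

  -- Equality of φ and χ as classes; because ⟷ is built from ∼ and ∧ only, this
  -- identifies φ with ∼ ∼ φ without assuming excluded middle.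
  _≋_ : ∀ {s} → Rel (Fm s) (p L.⊔ L.suc ℓ)
  φ ≋ χ = Valid (φ ⟷ χ)

  ≋-isEquivalence : ∀ {s} → IsEquivalence (_≋_ {s})
  ≋-isEquivalence = record
    { refl  = λ v w → (λ (a , ¬a) → ¬a a) , (λ (a , ¬a) → ¬a a)
    ; sym   = λ φχ v w → proj₂ (φχ v w) , proj₁ (φχ v w)
    ; trans = λ φχ χω v w →
        (λ (a , ¬c) → proj₁ (φχ v w) (a , λ b → proj₁ (χω v w) (b , ¬c))) ,
        (λ (c , ¬a) → proj₂ (χω v w) (c , λ b → proj₂ (φχ v w) (b , ¬a)))
    }

  ≋-refl : ∀ {s} (φ : Fm s) → φ ≋ φ
  ≋-refl φ = IsEquivalence.refl ≋-isEquivalence {φ}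

  IsLeftSemiconcept IsRightSemiconcept : Pred (Fm s₁ × Fm s₂) (p L.⊔ L.suc ℓ)
  IsLeftSemiconcept  (φ , ψ) = Valid (⊟𝔬 φ ⟷ ψ)
  IsRightSemiconcept (φ , ψ) = Valid (φ ⟷ ⊟𝔭 ψ)

  SCˡ SCʳ : Set (p L.⊔ L.suc ℓ)
  SCˡ = Σ (Fm s₁ × Fm s₂) IsLeftSemiconcept
  SCʳ = Σ (Fm s₁ × Fm s₂) IsRightSemiconcept

  extent : SCˡ → Fm s₁
  extent ((φ , ψ) , _) = φ

  intent : SCʳ → Fm s₂
  intent ((φ , ψ) , _) = ψ

  -- The quotients SCˡ/≡ˡ and SCʳ/≡ʳ are setoids: elements are representatives,
  -- and equality is the equivalence relation divided out.
  _≡ˡ_ : Rel SCˡ (p L.⊔ L.suc ℓ)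
  a ≡ˡ b = extent a ≋ extent b

  _≡ʳ_ : Rel SCʳ (p L.⊔ L.suc ℓ)
  a ≡ʳ b = intent a ≋ intent b

  SCˡ/≡ SCʳ/≡ : Setoid (p L.⊔ L.suc ℓ) (p L.⊔ L.suc ℓ)
  SCˡ/≡ = record { _≈_ = _≡ˡ_ ; isEquivalence = On.isEquivalence extent ≋-isEquivalence }
  SCʳ/≡ = record { _≈_ = _≡ʳ_ ; isEquivalence = On.isEquivalence intent ≋-isEquivalence }

  classˡ : Fm s₁ → SCˡ
  classˡ φ = (φ , ⊟𝔬 φ) , ≋-refl (⊟𝔬 φ)

  classʳ : Fm s₂ → SCʳ
  classʳ ψ = (⊟𝔭 ψ , ψ) , ≋-refl (⊟𝔭 ψ)

  infixr 7 _∧ˡ_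
  infixr 6 _∨ʳ_
  infix  9 ¬ˡ_ ¬ʳ_

  _∧ˡ_ : Op₂ SCˡ
  a ∧ˡ b = classˡ (extent a ∧ extent b)

  ¬ˡ_ : Op₁ SCˡ
  ¬ˡ a = classˡ (∼ extent a)

  ⊥ˡ : SCˡ
  ⊥ˡ = classˡ (falsum s₁)

  -- Joining right semiconcepts conjoins their intents.
  _∨ʳ_ : Op₂ SCʳ
  a ∨ʳ b = classʳ (intent a ∧ intent b)

  ¬ʳ_ : Op₁ SCʳ
  ¬ʳ a = classʳ (∼ intent a)

  ⊤ʳ : SCʳ
  ⊤ʳ = classʳ (falsum s₂)

  ∼-cong : ∀ {s} {φ χ : Fm s} → φ ≋ χ → (∼ φ) ≋ (∼ χ)
  ∼-cong φχ v w =
    (λ (¬a , ¬¬b) → ¬¬b λ b → proj₂ (φχ v w) (b , ¬a)) ,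
    (λ (¬b , ¬¬a) → ¬¬a λ a → proj₁ (φχ v w) (a , ¬b))

  ∧-cong : ∀ {s} {φ φ′ χ χ′ : Fm s} → φ ≋ φ′ → χ ≋ χ′ → (φ ∧ χ) ≋ (φ′ ∧ χ′)
  ∧-cong φφ′ χχ′ v w =
    (λ ((a , b) , n) → proj₁ (φφ′ v w) (a , λ a′ → proj₁ (χχ′ v w) (b , λ b′ → n (a′ , b′)))) ,
    (λ ((a , b) , n) → proj₂ (φφ′ v w) (a , λ a′ → proj₂ (χχ′ v w) (b , λ b′ → n (a′ , b′))))

  ∧ˡ-cong : Congruent₂ _≡ˡ_ _∧ˡ_
  ∧ˡ-cong {a} {a′} {b} {b′} =
    ∧-cong {φ = extent a} {extent a′} {extent b} {extent b′}

  ¬ˡ-cong : Congruent₁ _≡ˡ_ ¬ˡ_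
  ¬ˡ-cong {a} {b} = ∼-cong {φ = extent a} {extent b}

  ∨ʳ-cong : Congruent₂ _≡ʳ_ _∨ʳ_
  ∨ʳ-cong {a} {a′} {b} {b′} =
    ∧-cong {φ = intent a} {intent a′} {intent b} {intent b′}

  ¬ʳ-cong : Congruent₁ _≡ʳ_ ¬ʳ_
  ¬ʳ-cong {a} {b} = ∼-cong {φ = intent a} {intent b}

  -- Maps to and from the quotients are setoid functions, so e and e′ do not
  -- depend on the choice of representatives.
  module Induced {d}
    (𝔇 : Pred (Fm s₁ × Fm s₂) d)
    (𝒓  : Func (Subset 𝔇) SCˡ/≡) (𝒆  : Func SCˡ/≡ (Subset 𝔇))
    (𝒓′ : Func (Subset 𝔇) SCʳ/≡) (𝒆′ : Func SCʳ/≡ (Subset 𝔇))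
    where

    open Setoid (Subset 𝔇) public using (_≈_) renaming (Carrier to D)
    open Func 𝒓  public using () renaming (to to r)
    open Func 𝒆  public using () renaming (to to e)
    open Func 𝒓′ public using () renaming (to to r′)
    open Func 𝒆′ public using () renaming (to to e′)

    _⊓_ _⊔_ : Op₂ D
    x ⊓ y = e (r x ∧ˡ r y)
    x ⊔ y = e′ (r′ x ∨ʳ r′ y)

    ¬̄_ ⌟_ : Op₁ D
    ¬̄ x = e (¬ˡ r x)
    ⌟ x = e′ (¬ʳ r′ x)

    ⊥ᴰ ⊤ᴰ : D
    ⊥ᴰ = e ⊥ˡ
    ⊤ᴰ = e′ ⊤ʳ

record IsDoubleBooleanAlgebra {a ℓ} {D : Set a} (_≈_ : Rel D ℓ)
       (_⊔_ _⊓_ : Op₂ D) (¬̄_ ⌟_ : Op₁ D) (⊤ ⊥ : D) : Set (a L.⊔ ℓ) where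
  infixr 6 _∨̄_ _∧̄_

  _∨̄_ : Op₂ D
  x ∨̄ y = ¬̄ ((¬̄ x) ⊓ (¬̄ y))

  _∧̄_ : Op₂ D
  x ∧̄ y = ⌟ ((⌟ x) ⊔ (⌟ y))

  field
    isEquivalence : IsEquivalence _≈_
    ⊓-cong        : Congruent₂ _≈_ _⊓_
    ⊔-cong        : Congruent₂ _≈_ _⊔_
    ¬̄-cong        : Congruent₁ _≈_ ¬̄_
    ⌟-cong        : Congruent₁ _≈_ ⌟_

    ax1a  : ∀ x y → ((x ⊓ x) ⊓ y) ≈ (x ⊓ y)
    ax1b  : ∀ x y → ((x ⊔ x) ⊔ y) ≈ (x ⊔ y)
    ax2a  : Commutative _≈_ _⊓_
    ax2b  : Commutative _≈_ _⊔_
    ax3a  : ∀ x → (¬̄ (x ⊓ x)) ≈ (¬̄ x)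
    ax3b  : ∀ x → (⌟ (x ⊔ x)) ≈ (⌟ x)
    ax4a  : ∀ x y → (x ⊓ (x ⊔ y)) ≈ (x ⊓ x)
    ax4b  : ∀ x y → (x ⊔ (x ⊓ y)) ≈ (x ⊔ x)
    ax5a  : ∀ x y z → (x ⊓ (y ∨̄ z)) ≈ ((x ⊓ y) ∨̄ (x ⊓ z))
    ax5b  : ∀ x y z → (x ⊔ (y ∧̄ z)) ≈ ((x ⊔ y) ∧̄ (x ⊔ z))
    ax6a  : ∀ x y → (x ⊓ (x ∨̄ y)) ≈ (x ⊓ x)
    ax6b  : ∀ x y → (x ⊔ (x ∧̄ y)) ≈ (x ⊔ x)
    ax7a  : ∀ x y → (¬̄ (¬̄ (x ⊓ y))) ≈ (x ⊓ y)
    ax7b  : ∀ x y → (⌟ (⌟ (x ⊔ y))) ≈ (x ⊔ y)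
    ax8a  : ∀ x → (x ⊓ (¬̄ x)) ≈ ⊥
    ax8b  : ∀ x → (x ⊔ (⌟ x)) ≈ ⊤
    ax9a  : (¬̄ ⊤) ≈ ⊥
    ax9b  : (⌟ ⊥) ≈ ⊤
    ax10a : ∀ x y z → (x ⊓ (y ⊓ z)) ≈ ((x ⊓ y) ⊓ z)
    ax10b : ∀ x y z → (x ⊔ (y ⊔ z)) ≈ ((x ⊔ y) ⊔ z)
    ax11a : (¬̄ ⊥) ≈ (⊤ ⊓ ⊤)
    ax11b : (⌟ ⊤) ≈ (⊥ ⊔ ⊥)
    ax12  : ∀ x → ((x ⊓ x) ⊔ (x ⊓ x)) ≈ ((x ⊔ x) ⊓ (x ⊔ x))

record IsPureDoubleBooleanAlgebra {a ℓ} {D : Set a} (_≈_ : Rel D ℓ)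
       (_⊔_ _⊓_ : Op₂ D) (¬̄_ ⌟_ : Op₁ D) (⊤ ⊥ : D) : Set (a L.⊔ ℓ) where
  field
    isDoubleBooleanAlgebra : IsDoubleBooleanAlgebra _≈_ _⊔_ _⊓_ ¬̄_ ⌟_ ⊤ ⊥
    pure                   : ∀ x → ((x ⊓ x) ≈ x) ⊎ ((x ⊔ x) ≈ x)

  open IsDoubleBooleanAlgebra isDoubleBooleanAlgebra public

{-# OPTIONS --safe #-}

-- Each quotient is a Boolean algebra for conjunction (of extents, respectively
-- of intents), so SCʳ/≡ appears with its order reversed: its ∨ is the meet and
-- ⊤ʳ the least element. In this form the two halves of the double Boolean
-- algebra axioms are the same statement. Since r ∘ e = id, r turns ⊓, ¬̄ into ∧, ¬,
-- and x ⊓ x ≈ e (r x). Thus the axioms naming one half only are Boolean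
-- identities, while (12), (4), (11) and purity are (a), (b), (c) and (d); (9)
-- follows from (c) as well.
module Submission where

open import Defs
open import Algebra.Core using (Op₁; Op₂)
open import Algebra.Definitions using (Congruent₁; Congruent₂; Involutive)
open import Algebra.Lattice.Structures using (IsMeetSemilattice)
open import Data.Product using (_×_; _,_; proj₁; proj₂)
open import Data.Sum using (_⊎_)
import Data.Sum as Sum
open import Function.Bundles using (Func; _⇔_; mk⇔)
import Level as L
open import Relation.Binary.Bundles using (Setoid)
open import Relation.Binary.Core using (Rel)
open import Relation.Unary using (Pred)

-- Boolean algebras in the signature (∧, ¬, ⊥), the disjunction being
-- ¬ (¬ x ∧ ¬ y).
record IsNegationAlgebra {a ℓ} {A : Set a} (_≈_ : Rel A ℓ)
       (_∧_ : Op₂ A) (¬_ : Op₁ A) (⊥ : A) : Set (a L.⊔ ℓ) where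
  field
    isMeetSemilattice : IsMeetSemilattice _≈_ _∧_
    ¬-cong            : Congruent₁ _≈_ ¬_
    ¬-involutive      : Involutive _≈_ ¬_
    ∧-complement      : ∀ x → (x ∧ (¬ x)) ≈ ⊥
    ∧-absorbs-∨       : ∀ x y → (x ∧ (¬ ((¬ x) ∧ (¬ y)))) ≈ x
    ∧-distrib-∨       : ∀ x y z → (x ∧ (¬ ((¬ y) ∧ (¬ z)))) ≈
                                  (¬ ((¬ (x ∧ y)) ∧ (¬ (x ∧ z))))

  open IsMeetSemilattice _≈_ isMeetSemilattice public

record NegationAlgebra a ℓ : Set (L.suc (a L.⊔ ℓ)) where
  infix  9 ¬_
  infixr 7 _∧_
  infix  4 _≈_
  field
    Carrier           : Set a
    _≈_               : Rel Carrier ℓ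
    _∧_               : Op₂ Carrier
    ¬_                : Op₁ Carrier
    ⊥                 : Carrier
    isNegationAlgebra : IsNegationAlgebra _≈_ _∧_ ¬_ ⊥

  open IsNegationAlgebra isNegationAlgebra public

-- One half of the axioms: carrying a Boolean algebra along a retraction

module Retract {a ℓa d ℓd} (𝔸 : NegationAlgebra a ℓa) (𝔻 : Setoid d ℓd)
  (𝒓 : Func 𝔻 (NegationAlgebra.setoid 𝔸)) (𝒆 : Func (NegationAlgebra.setoid 𝔸) 𝔻)
  (r∘e : ∀ a → NegationAlgebra._≈_ 𝔸 (Func.to 𝒓 (Func.to 𝒆 a)) a)
  where

  open NegationAlgebra 𝔸 renaming (_≈_ to _≈ᴬ_; refl to reflᴬ; sym to symᴬ; trans to transᴬ)
  open Setoid 𝔻 using (_≈_; sym; trans) renaming (Carrier to D)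
  open Func 𝒓 using () renaming (to to r; cong to r-cong)
  open Func 𝒆 using () renaming (to to e; cong to e-cong)

  infixr 7 _⊓_
  infix  9 ⨼_

  _⊓_ : Op₂ D
  x ⊓ y = e (r x ∧ r y)

  ⨼_ : Op₁ D
  ⨼ x = e (¬ r x)

  ⊓-cong : Congruent₂ _≈_ _⊓_
  ⊓-cong x≈x′ y≈y′ = e-cong (∧-cong (r-cong x≈x′) (r-cong y≈y′))

  ⨼-cong : Congruent₁ _≈_ ⨼_
  ⨼-cong x≈y = e-cong (¬-cong (r-cong x≈y))

  r-⨼⊓⨼ : ∀ x y → r (⨼ x ⊓ ⨼ y) ≈ᴬ (¬ r x) ∧ (¬ r y)
  r-⨼⊓⨼ x y = transᴬ (r∘e _) (∧-cong (r∘e _) (r∘e _))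

  -- Every inner `e` meets an `r` and cancels, so `r` takes the disjunction derived from `⊓` and `⨼`
  -- to that of `𝔸`. This reduces (5) and (6) to Boolean identities.
  r-∨ : ∀ x y → r (⨼ (⨼ x ⊓ ⨼ y)) ≈ᴬ ¬ ((¬ r x) ∧ (¬ r y))
  r-∨ x y = transᴬ (r∘e _) (¬-cong (r-⨼⊓⨼ x y))

  ⊓-square : ∀ x → x ⊓ x ≈ e (r x)
  ⊓-square x = e-cong (idem (r x))

  -- `⊓` and `⨼` see their arguments only through `r`, which cannot tell `x ⊓ x` from `x`; hence (1)
  -- and (3).
  r-⊓-square : ∀ x → r (x ⊓ x) ≈ᴬ r x
  r-⊓-square x = transᴬ (r∘e _) (idem (r x))

  ⊓-squareˡ : ∀ x y → (x ⊓ x) ⊓ y ≈ x ⊓ y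
  ⊓-squareˡ x y = e-cong (∧-cong (r-⊓-square x) reflᴬ)

  ⊓-comm : ∀ x y → x ⊓ y ≈ y ⊓ x
  ⊓-comm x y = e-cong (comm (r x) (r y))

  ⊓-assoc : ∀ x y z → x ⊓ (y ⊓ z) ≈ (x ⊓ y) ⊓ z
  ⊓-assoc x y z = e-cong
    (transᴬ (∧-cong reflᴬ (r∘e _))
    (transᴬ (symᴬ (assoc (r x) (r y) (r z))) (∧-cong (symᴬ (r∘e _)) reflᴬ)))

  ⨼-square : ∀ x → ⨼ (x ⊓ x) ≈ ⨼ x
  ⨼-square x = e-cong (¬-cong (r-⊓-square x))

  -- In general a double `⨼` gives back only `e (r x)`; it is exact here because `x ⊓ y` already
  -- lies in the image of `e`.
  ⨼-involutive-⊓ : ∀ x y → ⨼ (⨼ (x ⊓ y)) ≈ x ⊓ y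
  ⨼-involutive-⊓ x y = e-cong
    (transᴬ (¬-cong (r∘e _)) (transᴬ (¬-involutive _) (r∘e _)))

  ⊓-distrib-∨ : ∀ x y z → x ⊓ ⨼ (⨼ y ⊓ ⨼ z) ≈ ⨼ (⨼ (x ⊓ y) ⊓ ⨼ (x ⊓ z))
  ⊓-distrib-∨ x y z = e-cong
    (transᴬ (∧-cong reflᴬ (r-∨ y z))
    (transᴬ (∧-distrib-∨ (r x) (r y) (r z))
    (¬-cong (symᴬ (transᴬ (r-⨼⊓⨼ (x ⊓ y) (x ⊓ z))
      (∧-cong (¬-cong (r∘e _)) (¬-cong (r∘e _))))))))

  ⊓-absorbs-∨ : ∀ x y → x ⊓ ⨼ (⨼ x ⊓ ⨼ y) ≈ x ⊓ x
  ⊓-absorbs-∨ x y = e-cong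
    (transᴬ (∧-cong reflᴬ (r-∨ x y))
    (transᴬ (∧-absorbs-∨ (r x) (r y)) (symᴬ (idem (r x)))))

  ⊓-complement : ∀ x → x ⊓ ⨼ x ≈ e ⊥
  ⊓-complement x = e-cong (transᴬ (∧-cong reflᴬ (r∘e _)) (∧-complement (r x)))

  ⨼-e⊥ : ⨼ (e ⊥) ≈ e (¬ ⊥)
  ⨼-e⊥ = e-cong (¬-cong (r∘e ⊥))

  -- `t` stands for the extreme element supplied by the other half: `⊤ᴰ` in `Left`, `⊥ᴰ` in `Right`.
  -- The hypothesis is then the matching half of (c).
  ⨼-of-¬⊥ : ∀ {t} → r t ≈ᴬ ¬ ⊥ → ⨼ t ≈ e ⊥
  ⨼-of-¬⊥ rt≈¬⊥ = e-cong (transᴬ (¬-cong rt≈¬⊥) (¬-involutive ⊥))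

  ⨼-e⊥-of-¬⊥ : ∀ {t} → r t ≈ᴬ ¬ ⊥ → ⨼ (e ⊥) ≈ t ⊓ t
  ⨼-e⊥-of-¬⊥ {t} rt≈¬⊥ = trans ⨼-e⊥ (trans (e-cong (symᴬ rt≈¬⊥)) (sym (⊓-square t)))

  -- Applying `r` to (11) recovers (c): one side becomes `r t`, the other `r (e (¬ ⊥))`.
  ¬⊥-of-⨼-e⊥ : ∀ {t} → ⨼ (e ⊥) ≈ t ⊓ t → r t ≈ᴬ ¬ ⊥
  ¬⊥-of-⨼-e⊥ {t} ⨼e⊥≈t⊓t =
    transᴬ (symᴬ (r-⊓-square t))
    (transᴬ (r-cong (trans (sym ⨼e⊥≈t⊓t) ⨼-e⊥)) (r∘e (¬ ⊥)))

-- Two retractions on one carrier: the axioms linking the halves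

module TwoRetracts {a ℓa b ℓb d ℓd}
  (𝔸 : NegationAlgebra a ℓa) (𝔹 : NegationAlgebra b ℓb) (𝔻 : Setoid d ℓd)
  (𝒓  : Func 𝔻 (NegationAlgebra.setoid 𝔸)) (𝒆  : Func (NegationAlgebra.setoid 𝔸) 𝔻)
  (𝒓′ : Func 𝔻 (NegationAlgebra.setoid 𝔹)) (𝒆′ : Func (NegationAlgebra.setoid 𝔹) 𝔻)
  (r∘e   : ∀ a → NegationAlgebra._≈_ 𝔸 (Func.to 𝒓 (Func.to 𝒆 a)) a)
  (r′∘e′ : ∀ b → NegationAlgebra._≈_ 𝔹 (Func.to 𝒓′ (Func.to 𝒆′ b)) b)
  where

  private
    module A     = NegationAlgebra 𝔸
    module B     = NegationAlgebra 𝔹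
    module Left  = Retract 𝔸 𝔻 𝒓 𝒆 r∘e
    module Right = Retract 𝔹 𝔻 𝒓′ 𝒆′ r′∘e′

  open Setoid 𝔻
  open Func 𝒓  using () renaming (to to r; cong to r-cong)
  open Func 𝒆  using () renaming (to to e; cong to e-cong)
  open Func 𝒓′ using () renaming (to to r′; cong to r′-cong)
  open Func 𝒆′ using () renaming (to to e′; cong to e′-cong)

  ⊥ᴰ ⊤ᴰ : Carrier
  ⊥ᴰ = e A.⊥
  ⊤ᴰ = e′ B.⊥

  -- Squaring with `⊓` is the projection `e ∘ r` and squaring with `⊔` is `e′ ∘ r′`, so (12) says
  -- that the two projections commute.
  square-⊓⊔ : ∀ x → (x Left.⊓ x) Right.⊓ (x Left.⊓ x) ≈ e′ (r′ (e (r x)))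
  square-⊓⊔ x = trans (Right.⊓-square _) (e′-cong (r′-cong (Left.⊓-square x)))

  square-⊔⊓ : ∀ x → (x Right.⊓ x) Left.⊓ (x Right.⊓ x) ≈ e (r (e′ (r′ x)))
  square-⊔⊓ x = trans (Left.⊓-square _) (e-cong (r-cong (Right.⊓-square x)))

  Conditions : Set _
  Conditions =
      (∀ x → e (r (e′ (r′ x))) ≈ e′ (r′ (e (r x))))
    × (∀ x y → (e (r x A.∧ r (e′ (r′ x B.∧ r′ y))) ≈ e (r x))
             × (e′ (r′ x B.∧ r′ (e (r x A.∧ r y))) ≈ e′ (r′ x)))
    × ((r (e′ B.⊥) A.≈ (A.¬ A.⊥)) × (r′ (e A.⊥) B.≈ (B.¬ B.⊥)))
    × (∀ x → (e (r x) ≈ x) ⊎ (e′ (r′ x) ≈ x))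

  IsPure : Set _
  IsPure = IsPureDoubleBooleanAlgebra _≈_ Right._⊓_ Left._⊓_ Left.⨼_ Right.⨼_ ⊤ᴰ ⊥ᴰ

  conditions : IsPure → Conditions
  conditions pdBa =
      (λ x → trans (sym (square-⊔⊓ x)) (trans (sym (ax12 x)) (square-⊓⊔ x)))
    , (λ x y → trans (ax4a x y) (Left.⊓-square x) , trans (ax4b x y) (Right.⊓-square x))
    , (Left.¬⊥-of-⨼-e⊥ ax11a , Right.¬⊥-of-⨼-e⊥ ax11b)
    , (λ x → Sum.map (trans (sym (Left.⊓-square x))) (trans (sym (Right.⊓-square x))) (pure x))
    where open IsPureDoubleBooleanAlgebra pdBa using (ax12; ax4a; ax4b; ax11a; ax11b; pure)

  isPure : Conditions → IsPure
  isPure (commute , absorb , (r⊤≈¬⊥ , r′⊥≈¬⊤) , fixed) = record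
    { isDoubleBooleanAlgebra = record
      { isEquivalence = isEquivalence
      ; ⊓-cong = Left.⊓-cong
      ; ⊔-cong = Right.⊓-cong
      ; ¬̄-cong = Left.⨼-cong
      ; ⌟-cong = Right.⨼-cong
      ; ax1a   = Left.⊓-squareˡ
      ; ax1b   = Right.⊓-squareˡ
      ; ax2a   = Left.⊓-comm
      ; ax2b   = Right.⊓-comm
      ; ax3a   = Left.⨼-square
      ; ax3b   = Right.⨼-square
      ; ax4a   = λ x y → trans (proj₁ (absorb x y)) (sym (Left.⊓-square x))
      ; ax4b   = λ x y → trans (proj₂ (absorb x y)) (sym (Right.⊓-square x))
      ; ax5a   = Left.⊓-distrib-∨
      ; ax5b   = Right.⊓-distrib-∨
      ; ax6a   = Left.⊓-absorbs-∨
      ; ax6b   = Right.⊓-absorbs-∨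
      ; ax7a   = Left.⨼-involutive-⊓
      ; ax7b   = Right.⨼-involutive-⊓
      ; ax8a   = Left.⊓-complement
      ; ax8b   = Right.⊓-complement
      ; ax9a   = Left.⨼-of-¬⊥ r⊤≈¬⊥
      ; ax9b   = Right.⨼-of-¬⊥ r′⊥≈¬⊤
      ; ax10a  = Left.⊓-assoc
      ; ax10b  = Right.⊓-assoc
      ; ax11a  = Left.⨼-e⊥-of-¬⊥ r⊤≈¬⊥
      ; ax11b  = Right.⨼-e⊥-of-¬⊥ r′⊥≈¬⊤
      ; ax12   = λ x → trans (square-⊓⊔ x) (trans (sym (commute x)) (sym (square-⊔⊓ x)))
      }
    ; pure = λ x → Sum.map (trans (Left.⊓-square x)) (trans (Right.⊓-square x)) (fixed x)
    }

-- Boolean laws for formulas and for the two quotients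

-- φ ≋ χ unfolds to φ → ¬ ¬ χ and χ → ¬ ¬ φ at every point, so the classical
-- tautologies below hold without excluded middle.
module Lindenbaum {p ℓ} (𝓛 : Language p) (𝕂 : Context ℓ) where
  open Formulas 𝓛
  open Semantics 𝓛 𝕂

  private variable s : Sort

  ∧-comm : (φ χ : Fm s) → (φ ∧ χ) ≋ (χ ∧ φ)
  ∧-comm φ χ v w = (λ ((a , b) , n) → n (b , a)) , (λ ((b , a) , n) → n (a , b))

  ∧-assoc : (φ χ ω : Fm s) → ((φ ∧ χ) ∧ ω) ≋ (φ ∧ (χ ∧ ω))
  ∧-assoc φ χ ω v w =
    (λ (((a , b) , c) , n) → n (a , b , c)) , (λ ((a , b , c) , n) → n ((a , b) , c))

  ∧-idem : (φ : Fm s) → (φ ∧ φ) ≋ φ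
  ∧-idem φ v w = (λ ((a , _) , ¬a) → ¬a a) , (λ (a , n) → n (a , a))

  ∼-involutive : (φ : Fm s) → (∼ ∼ φ) ≋ φ
  ∼-involutive φ v w = (λ (¬¬a , ¬a) → ¬¬a ¬a) , (λ (a , n) → n λ ¬a → ¬a a)

  -- Both sides are contradictions, so each implication is vacuous.
  ∧-complement : (φ : Fm s) → (φ ∧ ∼ φ) ≋ falsum s
  ∧-complement φ v w = (λ ((a , ¬a) , _) → ¬a a) , (λ ((a , ¬a) , _) → ¬a a)

  ∧-absorbs-∨ : (φ χ : Fm s) → (φ ∧ ∼ (∼ φ ∧ ∼ χ)) ≋ φ
  ∧-absorbs-∨ φ χ v w =
    (λ ((a , _) , ¬a) → ¬a a) , (λ (a , n) → n (a , λ (¬a , _) → ¬a a))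

  ∧-distrib-∨ : (φ χ ω : Fm s) → (φ ∧ ∼ (∼ χ ∧ ∼ ω)) ≋ (∼ (∼ (φ ∧ χ) ∧ ∼ (φ ∧ ω)))
  ∧-distrib-∨ φ χ ω v w =
    -- The target is itself a negation, so it may be proved by refutation: given `a`, denying both
    -- conjunctions denies both `χ` and `ω`.
    (λ ((a , b∨c) , n) → n λ (¬ab , ¬ac) → b∨c ((λ b → ¬ab (a , b)) , (λ c → ¬ac (a , c)))) ,
    -- The disjunction yields `φ` only under a double negation, so `n` is applied separately while
    -- refuting each disjunct, where `a` is at hand.
    (λ (ab∨ac , n) → ab∨ac ( (λ (a , b) → n (a , λ (¬b , _) → ¬b b))
                           , (λ (a , c) → n (a , λ (_ , ¬c) → ¬c c)) ))

  SCˡ-algebra : NegationAlgebra _ _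
  SCˡ-algebra = record
    { _≈_ = _≡ˡ_
    ; _∧_ = _∧ˡ_
    ; ¬_  = ¬ˡ_
    ; ⊥   = ⊥ˡ
    ; isNegationAlgebra = record
      { isMeetSemilattice = record
        { isBand = record
          { isSemigroup = record
            { isMagma = record
              { isEquivalence = Setoid.isEquivalence SCˡ/≡
              -- The representatives are passed by hand: `_≡ˡ_` unfolds to a statement about
              -- extents, from which they cannot be inferred.
              ; ∙-cong = λ {a} {a′} {b} {b′} → ∧ˡ-cong {a} {a′} {b} {b′}
              }
            ; assoc = λ a b c → ∧-assoc (extent a) (extent b) (extent c)
            }
          ; idem = λ a → ∧-idem (extent a)
          }
        ; comm = λ a b → ∧-comm (extent a) (extent b)
        }
      ; ¬-cong       = λ {a} {b} → ¬ˡ-cong {a} {b}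
      ; ¬-involutive = λ a → ∼-involutive (extent a)
      ; ∧-complement = λ a → ∧-complement (extent a)
      ; ∧-absorbs-∨  = λ a b → ∧-absorbs-∨ (extent a) (extent b)
      ; ∧-distrib-∨  = λ a b c → ∧-distrib-∨ (extent a) (extent b) (extent c)
      }
    }

  SCʳ-algebra : NegationAlgebra _ _
  SCʳ-algebra = record
    { _≈_ = _≡ʳ_
    ; _∧_ = _∨ʳ_
    ; ¬_  = ¬ʳ_
    ; ⊥   = ⊤ʳ
    ; isNegationAlgebra = record
      { isMeetSemilattice = record
        { isBand = record
          { isSemigroup = record
            { isMagma = record
              { isEquivalence = Setoid.isEquivalence SCʳ/≡
              ; ∙-cong = λ {a} {a′} {b} {b′} → ∨ʳ-cong {a} {a′} {b} {b′}
              }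
            ; assoc = λ a b c → ∧-assoc (intent a) (intent b) (intent c)
            }
          ; idem = λ a → ∧-idem (intent a)
          }
        ; comm = λ a b → ∧-comm (intent a) (intent b)
        }
      ; ¬-cong       = λ {a} {b} → ¬ʳ-cong {a} {b}
      ; ¬-involutive = λ a → ∼-involutive (intent a)
      ; ∧-complement = λ a → ∧-complement (intent a)
      ; ∧-absorbs-∨  = λ a b → ∧-absorbs-∨ (intent a) (intent b)
      ; ∧-distrib-∨  = λ a b c → ∧-distrib-∨ (intent a) (intent b) (intent c)
      }
    }

theorem5p2 : ∀ {p ℓ d} (𝓛 : Language p) (𝕂 : Context ℓ) →
    let open Formulas 𝓛
        open Semantics 𝓛 𝕂 in
    (𝔇 : Pred (Fm s₁ × Fm s₂) d)
    (𝒓 : Func (Subset 𝔇) SCˡ/≡) (𝒆 : Func SCˡ/≡ (Subset 𝔇))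
    (𝒓′ : Func (Subset 𝔇) SCʳ/≡) (𝒆′ : Func SCʳ/≡ (Subset 𝔇)) →
    let open Induced 𝔇 𝒓 𝒆 𝒓′ 𝒆′ in
    (∀ a → r (e a) ≡ˡ a) →
    (∀ b → r′ (e′ b) ≡ʳ b) →
    IsPureDoubleBooleanAlgebra _≈_ _⊔_ _⊓_ ¬̄_ ⌟_ ⊤ᴰ ⊥ᴰ
      ⇔
    ( (∀ x → e (r (e′ (r′ x))) ≈ e′ (r′ (e (r x))))
    × (∀ x y → (e (r x ∧ˡ r (e′ (r′ x ∨ʳ r′ y))) ≈ e (r x))
             × (e′ (r′ x ∨ʳ r′ (e (r x ∧ˡ r y))) ≈ e′ (r′ x)))
    × ((r (e′ ⊤ʳ) ≡ˡ (¬ˡ ⊥ˡ)) × (r′ (e ⊥ˡ) ≡ʳ (¬ʳ ⊤ʳ)))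
    × (∀ x → (e (r x) ≈ x) ⊎ (e′ (r′ x) ≈ x)) )
-- The operations of `Induced` are definitionally those of `Left` and `Right`, with `∨ʳ` as the meet
-- of `𝔹`, so the two sides are `IsPure` and `Conditions` on the nose.
theorem5p2 𝓛 𝕂 𝔇 𝒓 𝒆 𝒓′ 𝒆′ r∘e r′∘e′ = mk⇔ conditions isPure
  where
  open Lindenbaum 𝓛 𝕂
  open TwoRetracts SCˡ-algebra SCʳ-algebra (Subset 𝔇) 𝒓 𝒆 𝒓′ 𝒆′ r∘e r′∘e′
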